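{- Let $k \ge 2$ be an integer and let $G$ be a complete directed graph of order at least $k+2\Omega(k)$ in which every vertex and every edge is assigned a weight in $\mathbb{Z}_k$. Then $G$ contains a directed cycle whose weight is $0$ in $\mathbb{Z}_k$.
   Context: All graphs are simple. A complete directed graph has, for every ordered pair $(x,y)$ of distinct vertices, exactly one directed edge $xy$; in particular a pair of opposite edges $x,y$ forms a directed cycle of length 2. The weight of a subgraph is the sum (in $\mathbb{Z}_k$) of the weights of its vertices and edges. $\Omega(k)$ denotes the number of prime factors of $k$ counted with multiplicity. -}

module Defs where

open import Data.Nat using (ℕ; zero; suc; _+_; _≤_)
open import Data.Nat.ListAction using (sum)
open import Data.Nat.Primality.Factorisation using (factorise; PrimeFactorisation)
open import Data.Fin using (Fin; toℕ)
open import Data.List using (List; []; _∷_; length; map; zip; _++_; [_])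
open import Data.List.Relation.Unary.Unique.Propositional using (Unique)
open import Data.Product using (_×_; _,_; proj₁; proj₂)

-- Ω(k): number of prime factors of k counted with multiplicity
-- (length of the library's prime factorisation; Ω 0 = 0 is an unused convention).
Ω : ℕ → ℕ
Ω zero = 0
Ω (suc n) = length (PrimeFactorisation.factors (factorise (suc n)))

-- A complete directed graph on vertex set Fin n with weights in ℤ_k
-- (represented by Fin k): a weight on each vertex and on each ordered pair
-- (x , y) of vertices; values on the diagonal (x , x) are irrelevant, since
-- the graph is simple and only edges between distinct vertices are used.
record WeightedCompleteDigraph (n k : ℕ) : Set where
  field
    vw : Fin n → Fin k
    ew : Fin n → Fin n → Fin k

-- A directed cycle given by its first vertex v and the remaining vertices vs
-- (in order): vertices v ∷ vs are pairwise distinct, there are at least 2 of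
-- them, and its edges are consecutive pairs plus the closing edge back to v.
cycleVertices : ∀ {n} → Fin n → List (Fin n) → List (Fin n)
cycleVertices v vs = v ∷ vs

cycleEdges : ∀ {n} → Fin n → List (Fin n) → List (Fin n × Fin n)
cycleEdges v vs = zip (v ∷ vs) (vs ++ [ v ])

record IsDirectedCycle {n : ℕ} (v : Fin n) (vs : List (Fin n)) : Set where
  field
    distinct : Unique (cycleVertices v vs)
    nonTrivial : 1 ≤ length vs

-- weight of the cycle, as a natural number; its class in ℤ_k is zero iff k ∣ it
cycleWeight : ∀ {n k} → WeightedCompleteDigraph n k → Fin n → List (Fin n) → ℕ
cycleWeight {n} {k} G v vs =
  sum (map (λ x → toℕ (vw x)) (cycleVertices v vs))
  + sum (map (λ e → toℕ (ew (proj₁ e) (proj₂ e))) (cycleEdges v vs))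
  where open WeightedCompleteDigraph G

{-# OPTIONS --safe #-}

-- Adding each vertex weight to the edges leaving the vertex, only edges carry weights.  Fix a
-- root x.  For a set U of remaining vertices and z ∈ U, let N z ⊆ ℤ/k be a set of negated
-- weights of paths from z to x with interior outside U.  Starting from U = V ∖ {x}, vertices
-- are moved out of U so that always |N z| ≥ t for all z ∈ U and |U| + t > k; once t = k, the
-- edge from x to any z ∈ U closes a zero cycle.
--
-- Absorbing y replaces N z by N z ∪ (N y − w z y).  If some |N y| > t, absorb that y.
-- Otherwise all sizes are t; call z → y an arc when N y − w z y = N z.  If y has no incoming
-- arc, absorbing it makes all sets grow.  If every vertex has an incoming arc, then there are
-- cycles of arcs, whose weights are periods of the sets N z, so either one of them is a zero
-- cycle or every N z has a nontrivial period.  In the latter case, if some pair z, y is not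
-- an arc, then absorbing y enlarges N z by at least two (as ℤ/k has at most one involution),
-- and absorbing z next costs two vertices for a gain of two.  If all pairs are arcs, then up
-- to a potential all weights within U lie in the period group dℤ/k of N z, whose order
-- m = k/d divides t < k; hence |U| > k − t ≥ m and induction on k applies.

module Submission where

open import Defs
open import Data.Bool using (Bool; true; false; _∧_; _∨_; not)
import Data.Bool.Properties as Bool
open import Data.Fin as Fin using (Fin; toℕ)
open import Data.List using (List; []; _∷_; length; map; zip; _++_; [_])
open import Data.List.Membership.Propositional using (_∈_; _∉_; find; lose)
open import Data.List.Properties using (length-removeAt′; length-tabulate)
open import Data.List.Relation.Unary.All as All using (All; []; _∷_)
import Data.List.Relation.Unary.All.Properties as All
open import Data.List.Relation.Unary.AllPairs using ([]; _∷_)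
open import Data.List.Relation.Unary.Any using (here; there; any?; index; _─_)
open import Data.List.Relation.Unary.Unique.Propositional using (Unique)
open import Data.List.Relation.Unary.Unique.Propositional.Properties using (allFin⁺)
open import Data.Nat
open import Data.Nat.Divisibility
open import Data.Nat.DivMod using (_%_; _/_; m≡m%n+[m/n]*n; m%n<n; m*[n/m]≡n)
open import Data.Nat.Induction using (<-wellFounded)
open import Data.Nat.ListAction using (sum)
open import Data.Nat.Primality.Factorisation using (factorise)
open import Data.Nat.Properties
open import Data.Nat.Tactic.RingSolver using (solve-∀)
open import Data.Product using (Σ; ∃; _×_; _,_; proj₁; proj₂)
open import Data.Sum using (_⊎_; inj₁; inj₂)
open import Function.Base using (id)
open import Function.Bundles using (mk⇔)
open import Induction.WellFounded using (Acc; acc)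
open import Relation.Binary.Definitions using (DecidableEquality)
open import Relation.Binary.PropositionalEquality
  using (_≡_; _≢_; refl; sym; trans; cong; cong₂; subst; subst₂; ≢-sym; module ≡-Reasoning)
open import Relation.Nullary using (¬_; Dec; yes; no; does; contradiction; ¬?; _×-dec_)
open import Relation.Nullary.Decidable using (decidable-stable; dec-true; does-⇔)
open import Relation.Unary using (Decidable)

private
  variable
    f g h l : ℕ → Bool
    s t : ℕ

-- Counting the residues that satisfy a Boolean predicate.

indicator : Bool → ℕ
indicator true  = 1
indicator false = 0

count : ℕ → (ℕ → Bool) → ℕ
count zero    f = 0
count (suc n) f = indicator (f n) + count n f

count-cong : ∀ n → (∀ r → f r ≡ g r) → count n f ≡ count n g
count-cong zero    e = refl
count-cong (suc n) e = cong₂ _+_ (cong indicator (e n)) (count-cong n e)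

count-suc : ∀ n f → count (suc n) f ≡ indicator (f 0) + count n (λ r → f (suc r))
count-suc zero    f = refl
count-suc (suc n) f = trans (cong (indicator (f (suc n)) +_) (count-suc n f))
  (swap (indicator (f (suc n))) (indicator (f 0)) _)
  where
  swap : ∀ a b c → a + (b + c) ≡ b + (a + c)
  swap = solve-∀

count-≤ : ∀ n f → count n f ≤ n
count-≤ zero    f = z≤n
count-≤ (suc n) f with f n
... | true  = s≤s (count-≤ n f)
... | false = m≤n⇒m≤1+n (count-≤ n f)

count-full : ∀ n f → n ≤ count n f → ∀ {i} → i < n → f i ≡ true
count-full (suc n) f n<c i<n with f n in eq
... | false = contradiction n<c (≤⇒≯ (count-≤ n f))
... | true with m<1+n⇒m<n∨m≡n i<n
...   | inj₁ i<n′ = count-full n f (s≤s⁻¹ n<c) i<n′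
...   | inj₂ refl = eq

count-pos : ∀ n f {i} → i < n → f i ≡ true → 1 ≤ count n f
count-pos (suc n) f i<n fi with m<1+n⇒m<n∨m≡n i<n
... | inj₁ i<n′ = ≤-trans (count-pos n f i<n′ fi) (m≤n+m _ (indicator (f n)))
... | inj₂ refl rewrite fi = s≤s z≤n

count-witness : ∀ n f → 1 ≤ count n f → ∃ λ i → f i ≡ true
count-witness (suc n) f 1≤c with f n in eq
... | true  = n , eq
... | false = count-witness n f 1≤c

-- Reduces cardinality identities for sets to a truth table at each point.
count-interchange :
  (∀ r → indicator (f r) + indicator (g r) ≡ indicator (h r) + indicator (l r)) →
  ∀ n → count n f + count n g ≡ count n h + count n l
count-interchange e zero = refl
count-interchange {f} {g} {h} {l} e (suc n) = begin
  (indicator (f n) + count n f) + (indicator (g n) + count n g) ≡⟨ mid (indicator (f n)) _ _ _ ⟩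
  (indicator (f n) + indicator (g n)) + (count n f + count n g) ≡⟨ cong₂ _+_ (e n) (count-interchange e n) ⟩
  (indicator (h n) + indicator (l n)) + (count n h + count n l) ≡⟨ mid (indicator (h n)) _ _ _ ⟩
  (indicator (h n) + count n h) + (indicator (l n) + count n l) ∎
  where
  open ≡-Reasoning
  mid : ∀ a b c d → (a + b) + (c + d) ≡ (a + c) + (b + d)
  mid = solve-∀

_∪_ _∖_ : (ℕ → Bool) → (ℕ → Bool) → ℕ → Bool
(f ∪ g) r = f r ∨ g r
(f ∖ g) r = f r ∧ not (g r)

∖-swap : ∀ n f g → count n f + count n (g ∖ f) ≡ count n g + count n (f ∖ g)
∖-swap n f g = count-interchange (λ r → table (f r) (g r)) n
  where
  table : ∀ x y → indicator x + indicator (y ∧ not x) ≡ indicator y + indicator (x ∧ not y)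
  table true  true  = refl
  table true  false = refl
  table false true  = refl
  table false false = refl

count-∪ : ∀ n f g → count n (f ∪ g) ≡ count n f + count n (g ∖ f)
-- The empty set pads the left side to the two terms that `count-interchange` expects.
count-∪ n f g = trans (trans (sym (+-identityʳ _)) (cong (count n (f ∪ g) +_) (sym (none n))))
  (count-interchange (λ r → table (f r) (g r)) n)
  where
  none : ∀ m → count m (λ _ → false) ≡ 0
  none zero    = refl
  none (suc m) = none m
  table : ∀ x y → indicator (x ∨ y) + indicator false ≡ indicator x + indicator (y ∧ not x)
  table true  true  = refl
  table true  false = refl
  table false true  = refl
  table false false = refl

-- Periods, and sets of residues as periodic predicates.

Period : (ℕ → Bool) → ℕ → Set
Period f s = ∀ r → f (r + s) ≡ f r

period-+ : Period f s → Period f t → Period f (s + t)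
period-+ {f} {s} {t} p q r = trans (cong f (sym (+-assoc r s t))) (trans (q (r + s)) (p r))

period-* : ∀ c → Period f s → Period f (c * s)
period-* {f} zero    p r = cong f (+-identityʳ r)
period-* {f} (suc c) p   = period-+ {f} p (period-* {f} c p)

period-∣ : Period f s → s ∣ t → Period f t
period-∣ {f} p (divides c refl) = period-* {f} c p

period-∖ : Period f s → Period g s → Period (f ∖ g) s
period-∖ p q r = cong₂ (λ x y → x ∧ not y) (p r) (q r)

period-∪ : Period f s → Period g s → Period (f ∪ g) s
period-∪ p q r = cong₂ _∨_ (p r) (q r)

period-shift : Period f s → ∀ a → Period (λ r → f (r + a)) s
period-shift {f} {s} p a r = trans (cong f (swap r s a)) (p (r + a))
  where
  swap : ∀ r s a → r + s + a ≡ r + a + s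
  swap = solve-∀

period-% : .{{_ : NonZero s}} → Period f s → ∀ r → f r ≡ f (r % s)
period-% {s} {f} p r = trans (cong f (m≡m%n+[m/n]*n r s)) (period-* {f} (r / s) p (r % s))

-- A shift by one trades the value at 0 for the value at `k`, which periodicity makes equal; longer
-- shifts iterate this.
count-shift : ∀ {k} → Period f k → ∀ a → count k (λ r → f (r + a)) ≡ count k f
count-shift {f} {k} p a = trans (count-cong k (λ r → cong f (+-comm r a))) (go p a)
  where
  one : ∀ {f} → Period f k → count k (λ r → f (suc r)) ≡ count k f
  one {f} p = +-cancelˡ-≡ (indicator (f 0)) _ _
    (trans (sym (count-suc k f)) (cong (λ x → indicator x + count k f) (p 0)))
  go : ∀ {f} → Period f k → ∀ a → count k (λ r → f (a + r)) ≡ count k f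
  go p zero    = refl
  go {f} p (suc a) = trans (go {λ r → f (suc r)} (λ r → p (suc r)) a) (one {f} p)

count-blocks : Period f s → ∀ c → count (c * s) f ≡ c * count s f
count-blocks p zero = refl
count-blocks {f} {s} p (suc c) = trans (split s (c * s))
  (cong₂ _+_ (count-shift {f} p (c * s)) (count-blocks {f} p c))
  where
  split : ∀ m n → count (m + n) f ≡ count m (λ r → f (r + n)) + count n f
  split zero    n = refl
  split (suc m) n = trans (cong (indicator (f (m + n)) +_) (split m n))
    (sym (+-assoc (indicator (f (m + n))) _ _))

module _ {k : ℕ} .{{_ : NonZero k}} where

  1≤count : Period h k → ∀ {a} → h a ≡ true → 1 ≤ count k h
  1≤count {h} p {a} ha = count-pos k h (m%n<n a k) (trans (sym (period-% {k} {h} p a)) ha)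

  count-full-periodic : Period h k → k ≤ count k h → ∀ r → h r ≡ true
  count-full-periodic {h} p c r = trans (period-% {k} {h} p r) (count-full k h c (m%n<n r k))

  -- After translation by `a`, the two elements become the residues 0 and `s % k`, distinct because
  -- `k` does not divide `s`.
  2≤count : Period h k → ∀ {a s} → ¬ k ∣ s → h a ≡ true → h (a + s) ≡ true → 2 ≤ count k h
  2≤count {h} p {a} {s} k∤s ha has = subst (2 ≤_) (count-shift {h} p a)
    (go k (m%n<n s k) s%k≢0 (trans (sym (period-% {k} {h′} p′ s)) (trans (cong h (+-comm s a)) has)))
    where
    h′ = λ r → h (r + a)
    p′ : Period h′ k
    p′ = period-shift {h} p a
    s%k≢0 : s % k ≢ 0
    s%k≢0 e = k∤s (m%n≡0⇒n∣m s k e)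
    go : ∀ n {i} → i < n → i ≢ 0 → h′ i ≡ true → 2 ≤ count n h′
    go (suc n) {zero}  i<n i≢0 hi = contradiction refl i≢0
    go (suc n) {suc i} i<n i≢0 hi = subst (2 ≤_) (sym (count-suc n h′))
      (+-mono-≤ (≤-reflexive (sym (cong indicator ha))) (count-pos n _ (s≤s⁻¹ i<n) hi))

  agree? : Period f k → Period g k → (∃ λ r → f r ≢ g r) ⊎ (∀ r → f r ≡ g r)
  agree? {f} {g} p q with anyUpTo? (λ r → ¬? (f r Bool.≟ g r)) k
  ... | yes (r , _ , ne) = inj₁ (r , ne)
  ... | no none = inj₂ λ r → trans (period-% {k} {f} p r) (trans
        (decidable-stable (f (r % k) Bool.≟ g (r % k)) (λ ne → none (_ , m%n<n r k , ne)))
        (sym (period-% {k} {g} q r)))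

-- Elements of order two in ℤ/k.

data ParityView : ℕ → Set where
  even : ∀ m → ParityView (m + m)
  odd  : ∀ m → ParityView (suc (m + m))

parityView : ∀ n → ParityView n
parityView zero = even 0
parityView (suc n) with parityView n
... | even m = odd m
... | odd m  = subst ParityView (cong suc (+-suc m m)) (even (suc m))

double-injective : ∀ {m n} → m + m ≡ n + n → m ≡ n
double-injective {m} {n} e = *-cancelˡ-≡ m n 2 (trans (two m) (trans e (sym (two n))))
  where
  two : ∀ a → 2 * a ≡ a + a
  two = solve-∀

-- If `k` divides `s + s` but not `s`, the quotient is odd. Two odd quotients have an even sum, so
-- halving the sum of the two doubles leaves a multiple of `k`.
unique-involution : ∀ {k s t} → ¬ k ∣ s → ¬ k ∣ t → k ∣ s + s → k ∣ t + t → k ∣ s + t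
unique-involution {k} {s} {t} k∤s k∤t (divides p ep) (divides q eq) with parityView p | parityView q
... | even a | _ = contradiction (divides a (double-injective (trans ep (*-distribʳ-+ k a a)))) k∤s
... | _ | even b = contradiction (divides b (double-injective (trans eq (*-distribʳ-+ k b b)))) k∤t
... | odd a | odd b = divides (suc (a + b)) (double-injective (begin
  (s + t) + (s + t)                         ≡⟨ mid s t ⟩
  (s + s) + (t + t)                         ≡⟨ cong₂ _+_ ep eq ⟩
  suc (a + a) * k + suc (b + b) * k         ≡⟨ collect a b k ⟩
  suc (a + b) * k + suc (a + b) * k         ∎))
  where
  open ≡-Reasoning
  mid : ∀ s t → (s + t) + (s + t) ≡ (s + s) + (t + t)
  mid = solve-∀
  collect : ∀ a b k → suc (a + a) * k + suc (b + b) * k ≡ suc (a + b) * k + suc (a + b) * k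
  collect = solve-∀

-- Differences of two equally large periodic sets.

∖-intro : ∀ {x y} → x ≡ true → y ≡ false → x ∧ not y ≡ true
∖-intro refl refl = refl

∖-elim : ∀ {x y} → x ∧ not y ≡ true → x ≡ true × y ≡ false
∖-elim {true} {false} _ = refl , refl

module _ {k : ℕ} .{{_ : NonZero k}} {f g : ℕ → Bool}
  (pf : Period f k) (pg : Period g k) (same : count k f ≡ count k g) where

  private
    balanced : count k (g ∖ f) ≡ count k (f ∖ g)
    balanced = +-cancelˡ-≡ (count k f) _ _
      (trans (∖-swap k f g) (cong (_+ count k (f ∖ g)) (sym same)))

    1≤count-∖ : ∀ {r} → f r ≢ g r → 1 ≤ count k (f ∖ g)
    1≤count-∖ {r} ne with f r in ef | g r in eg
    ... | true  | true  = contradiction refl ne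
    ... | false | false = contradiction refl ne
    ... | true  | false = 1≤count (period-∖ {f} {k} {g} pf pg) {r} (∖-intro ef eg)
    ... | false | true  = subst (1 ≤_) balanced (1≤count (period-∖ {g} {k} {f} pg pf) {r} (∖-intro eg ef))

    -- The point `a + s` stays in `f` and `a + t` stays outside `g`. Unless one of them is a second
    -- element of `f` outside `g`, `a + s` lies in `g` and `a + t` outside `f`; then `a + s + t` is
    -- in `g` but not in `f`.
    second : ∀ {a s t} → f a ≡ true → g a ≡ false → Period f s → Period g t → ¬ k ∣ s → ¬ k ∣ t →
      2 ≤ count k (f ∖ g) ⊎ (g ∖ f) (a + s + t) ≡ true
    second {a} {s} {t} fa ga ps pt k∤s k∤t with g (a + s) in e₁ | f (a + t) in e₂
    ... | false | _ = inj₁ (2≤count (period-∖ {f} {k} {g} pf pg) {a} k∤s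
          (∖-intro fa ga) (∖-intro (trans (ps a) fa) e₁))
    ... | _ | true = inj₁ (2≤count (period-∖ {f} {k} {g} pf pg) {a} k∤t
          (∖-intro fa ga) (∖-intro e₂ (trans (pt a) ga)))
    ... | true | false = inj₂ (∖-intro (trans (pt (a + s)) e₁)
          (trans (cong f (swap a s t)) (trans (ps (a + t)) e₂)))
      where
      swap : ∀ a s t → a + s + t ≡ a + t + s
      swap = solve-∀

    -- If both periods have order two, they agree modulo `k`, so `a + s` is a second element.
    -- Otherwise one period can be doubled and stays nontrivial; using `second` with it and with its
    -- double gives two elements of `g` outside `f`, and the two differences have equal size.
    2≤count-∖ : ∀ {r s t} → f r ≢ g r → Period f s → Period g t → ¬ k ∣ s → ¬ k ∣ t →
      2 ≤ count k (f ∖ g)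
    2≤count-∖ {s = s} {t} ne ps pt k∤s k∤t with count-witness k (f ∖ g) (1≤count-∖ ne)
    ... | a , fga with ∖-elim {f a} {g a} fga | k ∣? s + s | k ∣? t + t
    ...   | fa , ga | yes k∣2s | yes k∣2t =
            2≤count (period-∖ {f} {k} {g} pf pg) {a} k∤s fga (∖-intro (trans (ps a) fa)
              (trans (sym (pt (a + s))) (trans (cong g (+-assoc a s t))
                (trans (period-∣ {g} pg (unique-involution k∤s k∤t k∣2s k∣2t) a) ga))))
    ...   | fa , ga | no k∤2s | _ with second {s = s} fa ga ps pt k∤s k∤t
                                     | second {s = s + s} fa ga (period-+ {f} ps ps) pt k∤2s k∤t
    ...     | inj₁ two | _ = two
    ...     | _ | inj₁ two = two
    ...     | inj₂ b | inj₂ c = subst (2 ≤_) balanced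
              (2≤count (period-∖ {g} {k} {f} pg pf) {a + s + t} k∤s b (trans (cong (g ∖ f) (swap a s t)) c))
      where
      swap : ∀ a s t → a + s + t + s ≡ a + (s + s) + t
      swap = solve-∀
    2≤count-∖ {s = s} {t} ne ps pt k∤s k∤t | a , fga | fa , ga | yes _ | no k∤2t
      with second {t = t} fa ga ps pt k∤s k∤t | second {t = t + t} fa ga ps (period-+ {g} pt pt) k∤s k∤2t
    ...     | inj₁ two | _ = two
    ...     | _ | inj₁ two = two
    ...     | inj₂ b | inj₂ c = subst (2 ≤_) balanced
              (2≤count (period-∖ {g} {k} {f} pg pf) {a + s + t} k∤t b (trans (cong (g ∖ f) (swap a s t)) c))
      where
      swap : ∀ a s t → a + s + t + t ≡ a + s + (t + t)
      swap = solve-∀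

  count-∪-strict : ∀ {r} → f r ≢ g r → suc (count k f) ≤ count k (f ∪ g)
  count-∪-strict ne = begin
    suc (count k f)                ≡⟨ +-comm 1 (count k f) ⟩
    count k f + 1                  ≤⟨ +-monoʳ-≤ (count k f) (1≤count-∖ ne) ⟩
    count k f + count k (f ∖ g)    ≡⟨ cong (count k f +_) balanced ⟨
    count k f + count k (g ∖ f)    ≡⟨ count-∪ k f g ⟨
    count k (f ∪ g)                ∎
    where open ≤-Reasoning

  count-∪-periodic : ∀ {r s t} → f r ≢ g r → Period f s → Period g t → ¬ k ∣ s → ¬ k ∣ t →
    2 + count k f ≤ count k (f ∪ g)
  count-∪-periodic ne ps pt k∤s k∤t = begin
    2 + count k f                  ≡⟨ +-comm 2 (count k f) ⟩
    count k f + 2                  ≤⟨ +-monoʳ-≤ (count k f) (2≤count-∖ ne ps pt k∤s k∤t) ⟩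
    count k f + count k (f ∖ g)    ≡⟨ cong (count k f +_) balanced ⟨
    count k f + count k (g ∖ f)    ≡⟨ count-∪ k f g ⟨
    count k (f ∪ g)                ∎
    where open ≤-Reasoning

-- The least positive period.

least : {P : ℕ → Set} → Decidable P → ∀ n →
  (∃ λ d → P d × (∀ {j} → j < d → ¬ P j)) ⊎ (∀ {j} → j < n → ¬ P j)
least P? zero = inj₂ λ ()
least {P} P? (suc n) with least P? n
... | inj₁ found = inj₁ found
... | inj₂ none with P? n
...   | yes Pn = inj₁ (n , Pn , none)
...   | no ¬Pn = inj₂ below
  where
  below : ∀ {j} → j < suc n → ¬ P j
  below j<n Pj with m<1+n⇒m<n∨m≡n j<n
  ... | inj₁ j<n′ = none j<n′ Pj
  ... | inj₂ refl = ¬Pn Pj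

period? : ∀ {k f} .{{_ : NonZero k}} → Period f k → Decidable (Period f)
period? {k} {f} p s with agree? {k} {λ r → f (r + s)} {f} (period-shift {f} p s) p
... | inj₁ (r , ne) = no λ q → ne (q r)
... | inj₂ q        = yes q

-- The remainder of any period on division by the least one is again a period, hence zero.
least-period : ∀ {k f} .{{_ : NonZero k}} → Period f k →
  ∃ λ d → NonZero d × Period f d × (∀ {s} → Period f s → d ∣ s)
least-period {k} {f} p
  -- The bound `suc k` lets the search reach `k`, itself a positive period.
  with least (λ d → (1 ≤? d) ×-dec period? {k} {f} p d) (suc k)
... | inj₂ none = contradiction (>-nonZero⁻¹ k , p) (none (n<1+n k))
... | inj₁ (d , (1≤d , pd) , minimal) = d , nz , pd , λ {s} ps → m%n≡0⇒n∣m s d (remainder s ps)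
  where
  instance
    nz : NonZero d
    nz = >-nonZero 1≤d
  remainder : ∀ s → Period f s → s % d ≡ 0
  remainder s ps with s % d in e
  ... | zero  = refl
  ... | suc m = contradiction (s≤s z≤n , pm) (minimal (subst (_< d) e (m%n<n s d)))
    where
    pm : Period f (suc m)
    pm r = trans (sym (period-* {f} (s / d) pd (r + suc m)))
      (trans (cong f (trans (+-assoc r (suc m) _)
        (cong (r +_) (trans (cong (_+ s / d * d) (sym e)) (sym (m≡m%n+[m/n]*n s d))))))
      (ps r))

-- Walks, zero cycles and change of potential.

module _ {V : Set} where

  private
    variable
      x y z : V
      xs : List V

  ∈-─⁺ : (y∈xs : y ∈ xs) → z ∈ xs → z ≢ y → z ∈ (xs ─ y∈xs)
  ∈-─⁺ (here refl) (here refl) ne = contradiction refl ne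
  ∈-─⁺ (here refl) (there z∈)  ne = z∈
  ∈-─⁺ (there y∈)  (here refl) ne = here refl
  ∈-─⁺ (there y∈)  (there z∈)  ne = there (∈-─⁺ y∈ z∈ ne)

  ∈-─⁻ : (y∈xs : y ∈ xs) → z ∈ (xs ─ y∈xs) → z ∈ xs
  ∈-─⁻ (here refl) z∈         = there z∈
  ∈-─⁻ (there y∈)  (here eq)  = here eq
  ∈-─⁻ (there y∈)  (there z∈) = there (∈-─⁻ y∈ z∈)

  unique-─ : Unique xs → (y∈xs : y ∈ xs) → Unique (xs ─ y∈xs)
  unique-─ (_ ∷ u) (here refl) = u
  unique-─ (p ∷ u) (there y∈)  = All.─⁺ y∈ p ∷ unique-─ u y∈

  ∉-─ : Unique xs → (y∈xs : y ∈ xs) → y ∉ (xs ─ y∈xs)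
  ∉-─ (p ∷ u) (here refl) y∈′         = All.lookup p y∈′ refl
  ∉-─ (p ∷ u) (there y∈)  (here refl) = All.lookup p y∈ refl
  ∉-─ (p ∷ u) (there y∈)  (there y∈′) = ∉-─ u y∈ y∈′

  walk : (V → V → ℕ) → V → List V → V → ℕ
  walk w x []       z = w x z
  walk w x (y ∷ ys) z = w x y + walk w y ys z

record ZeroCycle {V : Set} (k : ℕ) (w : V → V → ℕ) (U : List V) : Set where
  constructor zeroCycle
  field
    {start}     : V
    {rest}      : List V
    simple      : Unique (start ∷ rest)
    proper      : 1 ≤ length rest
    inside      : All (_∈ U) (start ∷ rest)
    zero-weight : k ∣ walk w start rest start

-- The factor κ stands for −1 modulo suc κ: on a closed walk the potential f contributes suc κ * Σ f.
walk-gauge : ∀ {V : Set} (w u : V → V → ℕ) (f : V → ℕ) d κ →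
  (P : V → Set) → (∀ {y z} → P y → P z → y ≢ z → d * u y z ≡ w y z + f z + κ * f y) →
  ∀ x ys z → Unique (x ∷ ys) → All (z ≢_) (x ∷ ys) → All P (x ∷ ys) → P z →
  d * walk u x ys z ≡ walk w x ys z + (sum (map f ys) + f z) + κ * (f x + sum (map f ys))
walk-gauge w u f d κ P e x [] z _ (z≢x ∷ []) (px ∷ []) pz =
  trans (e px pz (≢-sym z≢x)) (cong (λ m → w x z + f z + κ * m) (sym (+-identityʳ (f x))))
walk-gauge w u f d κ P e x (y ∷ ys) z ((x≢y ∷ _) ∷ uys) (_ ∷ z≢) (px ∷ py ∷ pys) pz = begin
  d * (u x y + walk u y ys z)         ≡⟨ *-distribˡ-+ d (u x y) _ ⟩
  d * u x y + d * walk u y ys z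
    ≡⟨ cong₂ _+_ (e px py x≢y) (walk-gauge w u f d κ P e y ys z uys z≢ (py ∷ pys) pz) ⟩
  (w x y + f y + κ * f x) + (walk w y ys z + (S + f z) + κ * (f y + S))
    ≡⟨ collect (w x y) (f y) κ (f x) (walk w y ys z) S (f z) ⟩
  (w x y + walk w y ys z) + (f y + S + f z) + κ * (f x + (f y + S)) ∎
  where
  open ≡-Reasoning
  S = sum (map f ys)
  collect : ∀ a b κ c m s t →
    (a + b + κ * c) + (m + (s + t) + κ * (b + s)) ≡ (a + m) + (b + s + t) + κ * (c + (b + s))
  collect = solve-∀

-- Around a cycle the potential cancels modulo `suc κ`, so the `w`-weight is congruent to `d` times
-- the `u`-weight, and `d * m` is the modulus.
cycle-gauge : ∀ {V : Set} (w u : V → V → ℕ) (f : V → ℕ) d κ {U} →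
  (∀ {y z} → y ∈ U → z ∈ U → y ≢ z → d * u y z ≡ w y z + f z + κ * f y) →
  ∀ {m} → d * m ≡ suc κ → ZeroCycle m u U → ZeroCycle (suc κ) w U
cycle-gauge w u f d κ {U} e {m} dm
  (zeroCycle {x} {y ∷ ys} uniq@((x≢y ∷ x≢ys) ∷ uys) pr ins@(px ∷ py ∷ pys) m∣) =
  zeroCycle uniq pr ins (∣m+n∣m⇒∣n (subst (suc κ ∣_) closed k∣) (m∣m*n (f x + (f y + S))))
  where
  S = sum (map f ys)
  k∣ : suc κ ∣ d * walk u x (y ∷ ys) x
  k∣ = subst (_∣ d * walk u x (y ∷ ys) x) dm (*-monoʳ-∣ d m∣)
  collect : ∀ a b κ c m s →
    (a + b + κ * c) + (m + (s + c) + κ * (b + s)) ≡ suc κ * (c + (b + s)) + (a + m)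
  collect = solve-∀
  -- The first edge is split off, since `walk-gauge` wants an end vertex distinct from all earlier
  -- ones.
  closed : d * walk u x (y ∷ ys) x ≡ suc κ * (f x + (f y + S)) + walk w x (y ∷ ys) x
  closed = trans (*-distribˡ-+ d (u x y) _) (trans
    (cong₂ _+_ (e px py x≢y) (walk-gauge w u f d κ (_∈ U) e y ys x uys (x≢y ∷ x≢ys) (py ∷ pys) px))
    (collect (w x y) (f y) κ (f x) (walk w y ys x) S))

restrict : ∀ {V : Set} {k w} {U U′ : List V} →
  (∀ {z} → z ∈ U → z ∈ U′) → ZeroCycle k w U → ZeroCycle k w U′
restrict U⊆U′ (zeroCycle u p i d) = zeroCycle u p (All.map U⊆U′ i) d

-- Search states and absorption of vertices.

module Search {V : Set} (_≟V_ : DecidableEquality V) (κ : ℕ) (w : V → V → ℕ) (U₀ : List V) where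

  open import Data.List.Membership.DecPropositional _≟V_ using (_∈?_)

  private
    k = suc κ

  -- Multiplication by `κ` is negation modulo `k`.
  cancel : ∀ {f} → Period f k → ∀ r a → f (r + κ * a + a) ≡ f r
  cancel {f} p r a = trans (cong f (regroup r κ a)) (period-* {f} a p r)
    where
    regroup : ∀ r κ a → r + κ * a + a ≡ r + a * suc κ
    regroup = solve-∀

  record Path (x : V) (U : List V) (z : V) (r : ℕ) : Set where
    constructor path
    field
      {interior} : List V
      simple     : Unique (z ∷ interior)
      used       : All (λ y → x ≢ y × y ∉ U × y ∈ U₀) interior
      weight     : k ∣ r + walk w z interior x

  -- r ∈ N z stands for a path of weight −r, so that every step is free of subtraction.  N z
  -- carries no information unless z is remaining.
  record State : Set where
    field
      root       : V
      remaining  : List V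
      N          : V → ℕ → Bool
      root-in    : root ∈ U₀
      root-used  : root ∉ remaining
      unique     : Unique remaining
      inside     : ∀ {z} → z ∈ remaining → z ∈ U₀
      period     : ∀ z → Period (N z) k
      sound      : ∀ {z r} → z ∈ remaining → N z r ≡ true → Path root remaining z r

  size : State → V → ℕ
  size S z = count k (State.N S z)

  module _ (S : State) where
    open State S

    -- A full `N z` contains the residue `w root z`, so some path from `z` to the root cancels the
    -- edge from the root to `z`.
    close : ∀ {z} → z ∈ remaining → k ≤ size S z → ZeroCycle k w U₀
    close {z} z∈ full with sound z∈ (count-full-periodic (period z) full (w root z))
    ... | path simple used weight =
      zeroCycle (((λ { refl → root-used z∈ }) ∷ All.map proj₁ used) ∷ simple) (s≤s z≤n)
        (root-in ∷ inside z∈ ∷ All.map (λ u → proj₂ (proj₂ u)) used) weight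

    absorb : ∀ {y} → y ∈ remaining → State
    absorb {y} y∈ = record
      { root      = root
      ; remaining = remaining ─ y∈
      ; N         = λ z → N z ∪ (λ r → N y (r + w z y))
      ; root-in   = root-in
      ; root-used = λ r∈ → root-used (∈-─⁻ y∈ r∈)
      ; unique    = unique-─ unique y∈
      ; inside    = λ z∈ → inside (∈-─⁻ y∈ z∈)
      ; period    = λ z → period-∪ {N z} {k} {λ r → N y (r + w z y)}
                      (period z) (period-shift {N y} (period y) (w z y))
      ; sound     = sound′
      }
      where
      shrink : ∀ {v} → root ≢ v × v ∉ remaining × v ∈ U₀ → root ≢ v × v ∉ (remaining ─ y∈) × v ∈ U₀
      shrink (a , b , c) = a , (λ v∈ → b (∈-─⁻ y∈ v∈)) , c
      sound′ : ∀ {z r} → z ∈ (remaining ─ y∈) → N z r ∨ N y (r + w z y) ≡ true → Path root (remaining ─ y∈) z r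
      sound′ {z} {r} z∈ e with N z r in eq
      ... | true with sound (∈-─⁻ y∈ z∈) eq
      ...   | path simple used weight = path simple (All.map shrink used) weight
      -- The new path is the edge from `z` to `y` followed by a path from `y`, whose interior misses
      -- `z` because `z` is still remaining.
      sound′ {z} {r} z∈ e | false with sound y∈ e
      ... | path simple used weight = path
        (((λ { refl → ∉-─ unique y∈ z∈ }) ∷ All.map (λ { (_ , v∉ , _) refl → v∉ (∈-─⁻ y∈ z∈) }) used) ∷ simple)
        (((λ { refl → root-used y∈ }) , ∉-─ unique y∈ , inside y∈) ∷ All.map shrink used)
        (subst (k ∣_) (+-assoc r (w z y) _) weight)

    -- The new set at `z` contains a translate of `N y`, so absorbing a vertex with a large set
    -- makes every set at least that large.
    size-absorb : ∀ {y} (y∈ : y ∈ remaining) z → size S y ≤ size (absorb y∈) z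
    size-absorb {y} y∈ z = begin
      count k (N y)                       ≡⟨ count-shift {N y} (period y) (w z y) ⟨
      count k B                           ≤⟨ m≤m+n _ _ ⟩
      count k B + count k (N z ∖ B)       ≡⟨ ∖-swap k (N z) B ⟨
      count k (N z) + count k (B ∖ N z)   ≡⟨ count-∪ k (N z) B ⟨
      count k (N z ∪ B)                   ∎
      where
      open ≤-Reasoning
      B = λ r → N y (r + w z y)

    -- Tight pairs, arcs and the periods they force.

    Tight : V → V → Set
    Tight z y = ∀ r → N z r ≡ N y (r + w z y)

    tight? : ∀ z y → (∃ λ r → N z r ≢ N y (r + w z y)) ⊎ Tight z y
    tight? z y = agree? {k} {N z} {λ r → N y (r + w z y)} (period z) (period-shift {N y} (period y) (w z y))

    Arc : V → V → Set
    Arc z y = z ≢ y × Tight z y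

    arc? : ∀ z y → Dec (Arc z y)
    arc? z y with z ≟V y | tight? z y
    ... | yes z≡y | _ = no λ (z≢y , _) → z≢y z≡y
    ... | no _    | inj₁ (r , ne) = no λ (_ , t) → ne (t r)
    ... | no z≢y  | inj₂ t = yes (z≢y , t)

    size-grow : ∀ {y} (y∈ : y ∈ remaining) {z} → z ≢ y → size S y ≡ size S z → ¬ Arc z y →
      suc (size S z) ≤ size (absorb y∈) z
    size-grow {y} y∈ {z} z≢y same ¬arc with tight? z y
    ... | inj₂ t = contradiction (z≢y , t) ¬arc
    ... | inj₁ (r , ne) = count-∪-strict (period z) (period-shift {N y} (period y) (w z y))
          (trans (sym same) (sym (count-shift {N y} (period y) (w z y)))) {r} ne

    Nontrivial : V → Set
    Nontrivial z = ∃ λ s → ¬ k ∣ s × Period (N z) s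

    size-grow₂ : ∀ {y} (y∈ : y ∈ remaining) {z} → z ≢ y → size S y ≡ size S z → ¬ Arc z y →
      Nontrivial z → Nontrivial y → 2 + size S z ≤ size (absorb y∈) z
    size-grow₂ {y} y∈ {z} z≢y same ¬arc (s , k∤s , ps) (t , k∤t , pt) with tight? z y
    ... | inj₂ ti = contradiction (z≢y , ti) ¬arc
    ... | inj₁ (r , ne) = count-∪-periodic (period z) (period-shift {N y} (period y) (w z y))
          (trans (sym same) (sym (count-shift {N y} (period y) (w z y)))) {r} ne
          ps (period-shift {N y} pt (w z y)) k∤s k∤t

    -- Tightness makes `N y` a translate of `N z`, and translates share their periods.
    period-transport : ∀ {z y s} → Tight z y → Period (N z) s → Period (N y) s
    period-transport {z} {y} {s} ti ps r = begin
      N y (r + s)                            ≡⟨ cancel {N y} (period y) (r + s) (w z y) ⟨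
      N y (r + s + κ * w z y + w z y)        ≡⟨ ti (r + s + κ * w z y) ⟨
      N z (r + s + κ * w z y)                ≡⟨ cong (N z) (swap r s (κ * w z y)) ⟩
      N z (r + κ * w z y + s)                ≡⟨ ps (r + κ * w z y) ⟩
      N z (r + κ * w z y)                    ≡⟨ ti (r + κ * w z y) ⟩
      N y (r + κ * w z y + w z y)            ≡⟨ cancel {N y} (period y) r (w z y) ⟩
      N y r                                  ∎
      where
      open ≡-Reasoning
      swap : ∀ a b c → a + b + c ≡ a + c + b
      swap = solve-∀

    data Chain : V → List V → Set where
      []  : ∀ {z} → Chain z []
      _∷_ : ∀ {z y ys} → Arc z y → Chain y ys → Chain z (y ∷ ys)

    -- A stretch of arcs from `z` to `y`. Listing `y` first in `simple` fits the cycle obtained once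
    -- an arc from `y` to `z` is added.
    record Segment (z y : V) (ys : List V) : Set where
      constructor segment
      field
        {inner} : List V
        simple  : Unique (y ∷ z ∷ inner)
        inner⊆  : ∀ {v} → v ∈ inner → v ∈ ys
        tight   : ∀ r → N z r ≡ N y (r + walk w z inner y)

    segment-to : ∀ {z y ys} → Chain z ys → Unique (z ∷ ys) → y ∈ ys → Segment z y ys
    segment-to ((z≢y , ti) ∷ c) u (here refl) =
      segment ((≢-sym z≢y ∷ []) ∷ [] ∷ []) (λ ()) ti
    segment-to {z} {y} {v ∷ ys} ((_ , ti) ∷ c) ((z≢v ∷ z≢ys) ∷ u) (there y∈) with segment-to c u y∈
    ... | segment {inner} ((y≢v ∷ y≢i) ∷ ui) sub tight = segment
      (((λ { refl → All.lookup z≢ys y∈ refl }) ∷ y≢v ∷ y≢i) ∷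
        (z≢v ∷ All.tabulate (λ v∈ → All.lookup z≢ys (sub v∈))) ∷ ui)
      (λ { (here eq) → here eq ; (there v∈) → there (sub v∈) })
      (λ r → trans (ti r) (trans (tight (r + w z v)) (cong (N y) (+-assoc r (w z v) _))))

    -- Following incoming arcs backwards from `z` must revisit a vertex. The weight of the resulting
    -- cycle of arcs is a period there; if it is not zero modulo `k`, it is carried forward along
    -- the arcs to `z`.
    nontrivial : (∀ {y} → y ∈ remaining → ∃ λ z → z ∈ remaining × Arc z y) →
      ∀ {z} → z ∈ remaining → ZeroCycle k w U₀ ⊎ Nontrivial z
    nontrivial pred {z₀} z₀∈ = go (length remaining) remaining ≤-refl z₀ [] (z₀∈ ∷ []) ([] ∷ []) []
      λ y∈ y∉ → y∈
      where
      transport : ∀ {z y} → Tight z y → ZeroCycle k w U₀ ⊎ Nontrivial z → ZeroCycle k w U₀ ⊎ Nontrivial y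
      transport ti (inj₁ c) = inj₁ c
      transport ti (inj₂ (s , k∤s , ps)) = inj₂ (s , k∤s , period-transport ti ps)

      -- `M` contains every remaining vertex not yet visited and loses one at each step, while `n`
      -- bounds its length.
      go : ∀ n M → length M ≤ n → ∀ z ys → All (_∈ remaining) (z ∷ ys) → Unique (z ∷ ys) → Chain z ys →
        (∀ {y} → y ∈ remaining → y ∉ z ∷ ys → y ∈ M) → ZeroCycle k w U₀ ⊎ Nontrivial z
      go n M len z ys (z∈ ∷ ys∈) u c unvisited with pred z∈
      ... | y , y∈ , y≢z , ti with y ∈? (z ∷ ys)
      ...   | yes (here refl) = contradiction refl y≢z
      ...   | yes (there y∈ys) with segment-to c u y∈ys
      ...     | segment {inner} simple sub tight with k ∣? walk w y (z ∷ inner) y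
      ...       | yes k∣ = inj₁ (zeroCycle simple (s≤s z≤n)
                    (inside y∈ ∷ inside z∈ ∷ All.tabulate (λ v∈ → inside (All.lookup ys∈ (sub v∈)))) k∣)
      ...       | no k∤ = transport ti (inj₂ (_ , k∤ , λ r → sym (trans (ti r) (trans (tight (r + w y z))
                            (cong (N y) (+-assoc r (w y z) _))))))
      go n M len z ys (z∈ ∷ ys∈) u c unvisited | y , y∈ , y≢z , ti | no y∉ with unvisited y∈ y∉
      go zero    (_ ∷ _) () z ys _ u c unvisited | y , y∈ , y≢z , ti | no y∉ | _
      go (suc n) M len z ys (z∈ ∷ ys∈) u c unvisited | y , y∈ , y≢z , ti | no y∉ | y∈M =
        transport ti (go n (M ─ y∈M) (s≤s⁻¹ (subst (_≤ suc n) (length-removeAt′ M (index y∈M)) len))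
          y (z ∷ ys) (y∈ ∷ z∈ ∷ ys∈) (All.¬Any⇒All¬ _ y∉ ∷ u) ((y≢z , ti) ∷ c)
          λ v∈ v∉ → ∈-─⁺ y∈M (unvisited v∈ (λ v∈′ → v∉ (there v∈′))) (λ { refl → v∉ (here refl) }))

    uniform : (∀ {m} (u : V → V → ℕ) → 1 ≤ m → m < k → m < length remaining → ZeroCycle m u remaining) →
      (∀ {z y} → z ∈ remaining → y ∈ remaining → z ≢ y → Tight z y) →
      ∀ {z₀} → z₀ ∈ remaining → 1 ≤ size S z₀ → size S z₀ < k → k < length remaining + size S z₀ →
      ZeroCycle k w U₀
    uniform rec tight {z₀} z₀∈ 1≤t t<k k<len with least-period {k} {N z₀} (period z₀)
    ... | d , nz , pd , multiple with multiple {k} (period z₀)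
    ...   | divides m k≡m*d = restrict inside
            (cycle-gauge w u φ d κ edge (trans (*-comm d m) (sym k≡m*d)) (rec u 1≤m m<k m<len))
      where
      instance
        d≢0 : NonZero d
        d≢0 = nz

      -- The potential: `N z` is `N z₀` translated by `φ z`, with value 0 at `z₀`, where no edge is
      -- available.
      φ : V → ℕ
      φ z with z ≟V z₀
      ... | yes _ = 0
      ... | no _  = w z z₀

      base : ∀ {z} → z ∈ remaining → ∀ r → N z r ≡ N z₀ (r + φ z)
      base {z} z∈ r with z ≟V z₀
      ... | yes refl = cong (N z) (sym (+-identityʳ r))
      ... | no z≢z₀  = tight z∈ z₀∈ z≢z₀ r

      numerator : V → V → ℕ
      numerator y z = w y z + φ z + κ * φ y

      u : V → V → ℕ
      u y z = numerator y z / d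

      -- Passing from `N y` to `N z` directly or through `N z₀` gives the same set, so the numerator
      -- is a period of `N z₀` and `d` divides it.
      edge : ∀ {y z} → y ∈ remaining → z ∈ remaining → y ≢ z → d * u y z ≡ numerator y z
      edge {y} {z} y∈ z∈ y≢z = m*[n/m]≡n (multiple λ r → begin
        N z₀ (r + numerator y z)               ≡⟨ cong (N z₀) (regroup r (w y z) (φ z) (κ * φ y)) ⟩
        N z₀ (r + κ * φ y + w y z + φ z)       ≡⟨ base z∈ _ ⟨
        N z (r + κ * φ y + w y z)              ≡⟨ tight y∈ z∈ y≢z _ ⟨
        N y (r + κ * φ y)                      ≡⟨ base y∈ _ ⟩
        N z₀ (r + κ * φ y + φ y)               ≡⟨ cancel {N z₀} (period z₀) r (φ y) ⟩
        N z₀ r                                 ∎)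
        where
        open ≡-Reasoning
        regroup : ∀ r a b c → r + (a + b + c) ≡ r + c + a + b
        regroup = solve-∀

      c = count d (N z₀)

      t≡m*c : size S z₀ ≡ m * c
      t≡m*c = trans (cong (λ n → count n (N z₀)) k≡m*d) (count-blocks {N z₀} pd m)

      1≤m : 1 ≤ m
      1≤m = n≢0⇒n>0 λ { refl → contradiction k≡m*d λ () }

      1≤c : 1 ≤ c
      1≤c = n≢0⇒n>0 λ c≡0 → <⇒≢ 1≤t (sym (trans t≡m*c (trans (cong (m *_) c≡0) (*-zeroʳ m))))

      c<d : c < d
      c<d = *-cancelˡ-< m c d (subst₂ _<_ t≡m*c k≡m*d t<k)

      -- `N z₀` consists of `c` of the `d` cosets of a group of order `m`; being a proper subset, it
      -- misses at least one whole coset.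
      m+t≤k : m + size S z₀ ≤ k
      m+t≤k = begin
        m + size S z₀   ≡⟨ cong (m +_) t≡m*c ⟩
        m + m * c       ≡⟨ *-suc m c ⟨
        m * suc c       ≤⟨ *-monoʳ-≤ m c<d ⟩
        m * d           ≡⟨ k≡m*d ⟨
        k               ∎
        where open ≤-Reasoning

      m<k : m < k
      m<k = <-≤-trans (m<m+n m 1≤t) m+t≤k

      m<len : m < length remaining
      m<len = +-cancelʳ-< (size S z₀) m (length remaining) (≤-<-trans m+t≤k k<len)

  length-absorb : ∀ (S : State) {y} (y∈ : y ∈ State.remaining S) →
    length (State.remaining S) ≡ suc (length (State.remaining (absorb S y∈)))
  length-absorb S y∈ = length-removeAt′ (State.remaining S) (index y∈)

  -- The search, given the result for smaller moduli.

  module _ (rec : ∀ {m} (u : V → V → ℕ) {U} → Unique U →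
                  1 ≤ m → m < k → m < length U → ZeroCycle m u U) where

    -- Each round raises `t` by at least the number of vertices it absorbs, which preserves
    -- `k < length + t`; `fuel` bounds the distance from `t` to `k`.
    search : ∀ fuel t → k ≤ fuel + t → t ≤ k → 1 ≤ t → (S : State) →
      k < length (State.remaining S) + t →
      (∀ {z} → z ∈ State.remaining S → t ≤ size S z) → ZeroCycle k w U₀

    search-below : ∀ fuel t → k ≤ suc fuel + t → t < k → 1 ≤ t → (S : State) →
      k < length (State.remaining S) + t →
      (∀ {z} → z ∈ State.remaining S → t ≤ size S z) → ZeroCycle k w U₀

    search fuel t k≤ t≤k 1≤t S k<len lower with t ≟ k
    search fuel t k≤ t≤k 1≤t S k<len lower | yes refl = nonempty (State.remaining S) refl k<len
      where
      nonempty : ∀ U → U ≡ State.remaining S → k < length U + k → ZeroCycle k w U₀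
      nonempty []      _    k<k = contradiction k<k (<-irrefl refl)
      nonempty (z ∷ U) refl _   = close S (here refl) (lower (here refl))
    search zero       t k≤ t≤k 1≤t S k<len lower | no t≢k = contradiction (≤-antisym t≤k k≤) t≢k
    search (suc fuel) t k≤ t≤k 1≤t S k<len lower | no t≢k =
      search-below fuel t k≤ (≤∧≢⇒< t≤k t≢k) 1≤t S k<len lower

    search-below fuel t k≤ t<k 1≤t S k<len lower = by-size
      where
      open State S

      next : ∀ {y} (y∈ : y ∈ remaining) → (∀ {z} → z ∈ (remaining ─ y∈) → suc t ≤ size (absorb S y∈) z) →
        ZeroCycle k w U₀
      next y∈ lower′ = search fuel (suc t) (subst (k ≤_) (sym (+-suc fuel t)) k≤) t<k (s≤s z≤n) (absorb S y∈)
        (subst (k <_) (trans (cong (_+ t) (length-absorb S y∈)) (sym (+-suc _ t))) k<len) lower′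

      module Exact (exact : ∀ {z} → z ∈ remaining → size S z ≡ t) where

        same : ∀ {y z} → y ∈ remaining → z ∈ remaining → size S y ≡ size S z
        same y∈ z∈ = trans (exact y∈) (sym (exact z∈))

        absorb-sink : ∀ {y} → y ∈ remaining → (∀ {z} → z ∈ remaining → ¬ Arc S z y) → ZeroCycle k w U₀
        absorb-sink y∈ sink = next y∈ λ {z} z∈ → subst (λ n → suc n ≤ size (absorb S y∈) z) (exact (∈-─⁻ y∈ z∈))
          (size-grow S y∈ (λ { refl → ∉-─ unique y∈ z∈ }) (same y∈ (∈-─⁻ y∈ z∈)) (sink (∈-─⁻ y∈ z∈)))

        absorb-pair : ∀ {y z} → y ∈ remaining → z ∈ remaining → z ≢ y → ¬ Arc S z y →
          Nontrivial S z → Nontrivial S y → ZeroCycle k w U₀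
        absorb-pair {y} {z} y∈ z∈ z≢y ¬arc nz ny =
          search fuel (2 + t)
            (≤-trans k≤ (≤-trans (n≤1+n _) (≤-reflexive (sym (trans (+-suc fuel (suc t)) (cong suc (+-suc fuel t)))))))
            -- A set of at least `2 + t` residues modulo `k` exists, so `2 + t` cannot exceed `k`.
            (≤-trans 2+t≤ (count-≤ k (State.N (absorb S y∈) z))) (s≤s z≤n) (absorb (absorb S y∈) z∈′)
            (subst (k <_) len k<len)
            -- Absorbing `z` second passes its enlarged set on to every other vertex.
            (λ {v} _ → ≤-trans 2+t≤ (size-absorb (absorb S y∈) z∈′ v))
          where
          z∈′ : z ∈ State.remaining (absorb S y∈)
          z∈′ = ∈-─⁺ y∈ z∈ z≢y
          2+t≤ : 2 + t ≤ size (absorb S y∈) z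
          2+t≤ = subst (λ n → 2 + n ≤ size (absorb S y∈) z) (exact z∈)
            (size-grow₂ S y∈ z≢y (same y∈ z∈) ¬arc nz ny)
          len : length remaining + t ≡ length (State.remaining (absorb (absorb S y∈) z∈′)) + (2 + t)
          len = trans (cong (_+ t) (trans (length-absorb S y∈) (cong suc (length-absorb (absorb S y∈) z∈′))))
            (sym (trans (+-suc _ (suc t)) (cong suc (+-suc _ t))))

        all-tight : (∀ {z y} → z ∈ remaining → y ∈ remaining → z ≢ y → Tight S z y) → ZeroCycle k w U₀
        all-tight tight = pick remaining refl
          where
          pick : ∀ U → U ≡ remaining → ZeroCycle k w U₀
          pick [] refl = contradiction (<-trans k<len t<k) (<-irrefl refl)
          pick (z ∷ U) refl = uniform S (λ u → rec u unique) tight (here refl)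
            (subst (1 ≤_) (sym e) 1≤t) (subst (_< k) (sym e) t<k)
            (subst (λ n → k < length remaining + n) (sym e) k<len)
            where
            e : size S z ≡ t
            e = exact (here refl)

        by-pair : (∀ {y} → y ∈ remaining → ∃ λ z → z ∈ remaining × Arc S z y) → ZeroCycle k w U₀
        by-pair pred with any? (λ y → any? (λ z → ¬? (z ≟V y) ×-dec ¬? (arc? S z y)) remaining) remaining
        ... | no none = all-tight λ {z} {y} z∈ y∈ z≢y →
              proj₂ (decidable-stable (arc? S z y) λ ¬arc → none (lose y∈ (lose z∈ (z≢y , ¬arc))))
        ... | yes some with find some
        ...   | y , y∈ , somez with find somez
        ...     | z , z∈ , z≢y , ¬arc with nontrivial S pred z∈ | nontrivial S pred y∈
        ...       | inj₁ cyc | _ = cyc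
        ...       | _ | inj₁ cyc = cyc
        ...       | inj₂ nz | inj₂ ny = absorb-pair y∈ z∈ z≢y ¬arc nz ny

        by-sink : ZeroCycle k w U₀
        by-sink with any? (λ y → ¬? (any? (λ z → arc? S z y) remaining)) remaining
        ... | yes some with find some
        ...   | y , y∈ , none = absorb-sink y∈ λ z∈ arc → none (lose z∈ arc)
        by-sink | no none = by-pair λ {y} y∈ →
          find (decidable-stable (any? (λ z → arc? S z y) remaining) λ ¬pred → none (lose y∈ ¬pred))

      by-size : ZeroCycle k w U₀
      by-size with any? (λ z → suc t ≤? size S z) remaining
      ... | yes some with find some
      ...   | y , y∈ , large = next y∈ λ {z} _ → ≤-trans large (size-absorb S y∈ z)
      by-size | no none = Exact.by-sink λ z∈ →
        ≤-antisym (≮⇒≥ λ t< → none (lose z∈ t<)) (lower z∈)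

-- The initial state and the induction on the modulus.

module _ {V : Set} (_≟V_ : DecidableEquality V) where

  -- Direct edges to the root are the first paths, so `N z` starts as the single residue of
  -- -`w z x`.
  initial : ∀ κ (w : V → V → ℕ) x U → Unique (x ∷ U) → Search.State _≟V_ κ w (x ∷ U)
  initial κ w x U (x≢ ∷ unique) = record
    { root      = x
    ; remaining = U
    ; N         = λ z r → does (suc κ ∣? r + w z x)
    ; root-in   = here refl
    ; root-used = λ x∈ → All.lookup x≢ x∈ refl
    ; unique    = unique
    ; inside    = there
    ; period    = λ z r → does-⇔ (mk⇔ (backward z r) (forward z r))
                    (suc κ ∣? r + suc κ + w z x) (suc κ ∣? r + w z x)
    ; sound     = λ {z} {r} _ e → Search.path ([] ∷ []) [] (holds (suc κ ∣? r + w z x) e)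
    }
    where
    holds : ∀ {A : Set} (a? : Dec A) → does a? ≡ true → A
    holds (yes a) _ = a
    move : ∀ r a k → r + k + a ≡ k + (r + a)
    move = solve-∀
    backward : ∀ z r → suc κ ∣ r + suc κ + w z x → suc κ ∣ r + w z x
    backward z r d = ∣m+n∣m⇒∣n (subst (suc κ ∣_) (move r (w z x) (suc κ)) d) ∣-refl
    forward : ∀ z r → suc κ ∣ r + w z x → suc κ ∣ r + suc κ + w z x
    forward z r d = subst (suc κ ∣_) (sym (move r (w z x) (suc κ))) (∣m∣n⇒∣m+n ∣-refl d)

  initial-size : ∀ κ w x U (u : Unique (x ∷ U)) z →
    1 ≤ Search.size _≟V_ κ w (x ∷ U) (initial κ w x U u) z
  initial-size κ w x U u@(_ ∷ _) z = 1≤count {h = State.N S z} (State.period S z) {κ * w z x}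
    (dec-true (suc κ ∣? κ * w z x + w z x) (divides (w z x) (regroup κ (w z x))))
    where
    open Search _≟V_ κ w (x ∷ U)
    S = initial κ w x U u
    regroup : ∀ κ a → κ * a + a ≡ a * suc κ
    regroup = solve-∀

  -- One vertex becomes the root and the search starts at `t = 1`. Modulus 1 is included because the
  -- period group in `uniform` may be trivial.
  zero-cycle : ∀ {k} → Acc _<_ k → (w : V → V → ℕ) → ∀ {U} → Unique U →
    1 ≤ k → k < length U → ZeroCycle k w U
  zero-cycle {suc κ} (acc rs) w {x ∷ U} u 1≤k k<len =
    search (λ w′ u′ 1≤m m<k → zero-cycle (rs m<k) w′ u′ 1≤m) κ 1 (≤-reflexive (+-comm 1 κ)) 1≤k ≤-refl
      (initial κ w x U u) (enough u) (λ {z} _ → initial-size κ w x U u z)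
    where
    open Search _≟V_ κ w (x ∷ U)
    enough : (u : Unique (x ∷ U)) → suc κ < length (State.remaining (initial κ w x U u)) + 1
    enough (_ ∷ _) = subst (suc κ <_) (+-comm 1 (length U)) k<len

-- From edge weights back to vertex and edge weights.

open WeightedCompleteDigraph

joint-weight : ∀ {n k} → WeightedCompleteDigraph n k → Fin n → Fin n → ℕ
joint-weight G x y = toℕ (vw G x) + toℕ (ew G x y)

-- Each vertex of `x ∷ ys` is left once and so charged once; on a cycle the end `z` is `x`, already
-- charged as the start.
walk-joint-weight : ∀ {n k} (G : WeightedCompleteDigraph n k) x ys z →
  walk (joint-weight G) x ys z ≡
    sum (map (λ x → toℕ (vw G x)) (x ∷ ys)) +
    sum (map (λ e → toℕ (ew G (proj₁ e) (proj₂ e))) (zip (x ∷ ys) (ys ++ [ z ])))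
walk-joint-weight G x []       z = sym (cong₂ _+_ (+-identityʳ (toℕ (vw G x))) (+-identityʳ (toℕ (ew G x z))))
walk-joint-weight G x (y ∷ ys) z = trans (cong (joint-weight G x y +_) (walk-joint-weight G y ys z))
  (interchange (toℕ (vw G x)) (toℕ (ew G x y)) _ _)
  where
  interchange : ∀ a b c d → (a + b) + (c + d) ≡ (a + c) + (b + d)
  interchange = solve-∀

-- An empty factorisation has product 1.
1≤Ω : ∀ k → 2 ≤ k → 1 ≤ Ω k
1≤Ω (suc n) 2≤k with factorise (suc n)
... | record { factors = []    ; isFactorisation = e } = contradiction 2≤k (<-irrefl (sym e))
... | record { factors = _ ∷ _ } = s≤s z≤n

theorem1 : (k : ℕ) → 2 ≤ k → (n : ℕ) → k + 2 * Ω k ≤ n →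
    (G : WeightedCompleteDigraph n k) →
    Σ (Fin n) λ v → Σ (List (Fin n)) λ vs →
    IsDirectedCycle v vs × (k ∣ cycleWeight G v vs)
theorem1 k 2≤k n order G
  with zero-cycle Fin._≟_ (<-wellFounded k) (joint-weight G) (allFin⁺ n) (<⇒≤ 2≤k)
         -- Since `Ω k` is positive, the order exceeds `k`, as `zero-cycle` requires.
         (subst (k <_) (sym (length-tabulate {n = n} id))
           (<-≤-trans (m<m+n k (≤-trans (1≤Ω k 2≤k) (m≤m+n (Ω k) _))) order))
... | zeroCycle {v} {vs} simple proper _ zero-weight =
      v , vs , record { distinct = simple ; nonTrivial = proper } ,
      subst (k ∣_) (walk-joint-weight G v vs v) zero-weight
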